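{- For $n>0$ (with $k\ge 0$ and $p$ integers), $$N_O(n,k,p)=2\left[\binom{n-1}{p}^2-\sum_{i=0}^{k-2}N_i^{n-1,p}\right],$$ where the sum is taken to be $0$ if $k<2$.
   Context: A lattice path of length $n$ here is a path in the plane starting at the origin $(0,0)$ and consisting of $n$ unit steps, each either E $=(1,0)$ or N $=(0,1)$. Let $M_{r,s}^{n,k}$ be the number of ordered pairs of lattice paths of length $n$ such that the first path ends at $(r,n-r)$, the second path ends at $(s,n-s)$, and the two paths intersect exactly $k$ times, where intersections at the origin and at the endpoints of the paths are not counted; that is, there are exactly $k$ indices $m$ with $1\le m\le n-1$ such that the two paths are at the same lattice point after $m$ steps. ($M_{r,s}^{n,k}=0$ unless $0\le r,s\le n$.) Put $N_k^{n,r}=M_{r,r}^{n,k}$. For an integer $p$ define $$N_O(n,k,p)=\sum_{r+s=2p+1} M_{r,s}^{n,k},$$ where the sum is over all ordered pairs of integers $(r,s)$ with $r+s=2p+1$. Binomial coefficients $\binom{a}{b}$ are $0$ unless $0\le b\le a$.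
   Formalization: The single case n = 1, k = 1, p = 0 is excluded: there the formula fails, since paths of length 1 have no interior point, so N_O(1,1,0) = 0, while the right-hand side equals 2. -}

module Defs where

open import Data.Fin.Base as Fin using (Fin; toℕ)
open import Data.Integer.Base as ℤ using (ℤ; +_; -[1+_]; 0ℤ; 1ℤ)
import Data.Integer.Properties as ℤ
open import Data.List.Base
  using (List; []; _∷_; map; filter; length; upTo; allFin; cartesianProduct; cartesianProductWith)
open import Data.List.Properties using (filter-none)
import Data.List.Relation.Unary.All as All
open import Data.Nat.Base as ℕ using (ℕ; zero; suc)
open import Data.Nat.Combinatorics using (_C_)
open import Data.Nat.ListAction using (sum)
import Data.Nat.Properties as ℕ
open import Data.Product.Base using (_×_; _,_; proj₁)
open import Data.Product.Properties using (≡-dec)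
open import Data.Vec.Base as Vec using (Vec)
open import Relation.Binary.Definitions using (DecidableEquality)
open import Relation.Binary.PropositionalEquality using (_≡_; refl; cong; subst)
open import Relation.Nullary.Decidable using (Dec; _×-dec_)
open import Relation.Nullary.Negation using (¬_)

Point : Set
Point = ℤ × ℤ

_≟ₚ_ : DecidableEquality Point
_≟ₚ_ = ≡-dec ℤ._≟_ ℤ._≟_

origin : Point
origin = 0ℤ , 0ℤ

_⊕_ : Point → Point → Point
(x , y) ⊕ (x′ , y′) = x ℤ.+ x′ , y ℤ.+ y′

data Step : Set where
  E N : Step

vector : Step → Point
vector E = 1ℤ , 0ℤ
vector N = 0ℤ , 1ℤ

Path : ℕ → Set
Path n = Vec Step n

-- The point reached after m steps, 0 ≤ m ≤ n.
position : ∀ {n} → Path n → Fin (suc n) → Point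
position v            Fin.zero    = origin
position (s Vec.∷ v) (Fin.suc m) = vector s ⊕ position v m

endpoint : ∀ {n} → Path n → Point
endpoint {n} v = position v (Fin.fromℕ n)

-- Both paths must be at the same point after the same number of steps m;
-- m < n rather than m ≤ n ∸ 1, so that n = 0 also gives no such m.
MeetsAt : ∀ {n} → Path n → Path n → Fin (suc n) → Set
MeetsAt {n} v w m = 1 ℕ.≤ toℕ m × toℕ m ℕ.< n × position v m ≡ position w m

meetsAt? : ∀ {n} (v w : Path n) (m : Fin (suc n)) → Dec (MeetsAt v w m)
meetsAt? {n} v w m =
  (1 ℕ.≤? toℕ m) ×-dec (toℕ m ℕ.<? n) ×-dec (position v m ≟ₚ position w m)

intersections : ∀ {n} → Path n → Path n → ℕ
intersections {n} v w = length (filter (meetsAt? v w) (allFin (suc n)))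

-- Every path of length n, each listed once.
paths : ∀ n → List (Path n)
paths zero    = Vec.[] ∷ []
paths (suc n) = cartesianProductWith Vec._∷_ (E ∷ N ∷ []) (paths n)

Admissible : ∀ n (k : ℕ) (r s : ℤ) → Path n × Path n → Set
Admissible n k r s (v , w) =
  endpoint v ≡ (r , + n ℤ.- r) × endpoint w ≡ (s , + n ℤ.- s) × intersections v w ≡ k

admissible? : ∀ n k r s (vw : Path n × Path n) → Dec (Admissible n k r s vw)
admissible? n k r s (v , w) =
  (endpoint v ≟ₚ (r , + n ℤ.- r)) ×-dec
  (endpoint w ≟ₚ (s , + n ℤ.- s)) ×-dec
  (intersections v w ℕ.≟ k)

-- M n k r s is M_{r,s}^{n,k}.
M : (n k : ℕ) (r s : ℤ) → ℕ
M n k r s = length (filter (admissible? n k r s) (cartesianProduct (paths n) (paths n)))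

-- Nₑ k n r is N_k^{n,r}.
Nₑ : (k n : ℕ) (r : ℤ) → ℕ
Nₑ k n r = M n k r r

InBox : ℕ → ℤ → ℤ → Set
InBox n r s = (0ℤ ℤ.≤ r × r ℤ.≤ + n) × (0ℤ ℤ.≤ s × s ℤ.≤ + n)

position-bounds : ∀ {n} (v : Path n) m →
                  0ℤ ℤ.≤ proj₁ (position v m) × proj₁ (position v m) ℤ.≤ + n
position-bounds v            Fin.zero    = ℤ.≤-refl , ℤ.+≤+ ℕ.z≤n
position-bounds (E Vec.∷ v) (Fin.suc m) =
  let l , u = position-bounds v m
  in ℤ.+-mono-≤ (ℤ.+≤+ {0} {1} ℕ.z≤n) l , ℤ.+-monoʳ-≤ 1ℤ u
position-bounds (N Vec.∷ v) (Fin.suc m) =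
  let l , u = position-bounds v m
  in ℤ.+-monoʳ-≤ 0ℤ l , ℤ.≤-trans (ℤ.+-monoʳ-≤ 0ℤ u) (ℤ.+≤+ (ℕ.n≤1+n _))

M-outside : ∀ n k r s → ¬ InBox n r s → M n k r s ≡ 0
M-outside n k r s ∉box =
  cong length (filter-none (admissible? n k r s)
    (All.universal notAdmissible (cartesianProduct (paths n) (paths n))))
  where
  bound : ∀ {t q} (v : Path n) → endpoint v ≡ (t , q) → 0ℤ ℤ.≤ t × t ℤ.≤ + n
  bound v eq = subst (λ t → 0ℤ ℤ.≤ t × t ℤ.≤ + n) (cong proj₁ eq)
                     (position-bounds v (Fin.fromℕ n))

  notAdmissible : ∀ vw → ¬ Admissible n k r s vw
  notAdmissible (v , w) (ev , ew , _) = ∉box (bound v ev , bound w ew)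

-- By M-outside, only pairs (r , s) in {0,…,n}² contribute to the sum over
-- all integer pairs with r + s = 2p + 1.
oddPairs : ℕ → ℤ → List (ℤ × ℤ)
oddPairs n p =
  filter (λ (r , s) → r ℤ.+ s ℤ.≟ + 2 ℤ.* p ℤ.+ 1ℤ) (cartesianProduct range range)
  where
  range : List ℤ
  range = map +_ (upTo (suc n))

N-O : (n k : ℕ) (p : ℤ) → ℕ
N-O n k p = sum (map (λ (r , s) → M n k r s) (oddPairs n p))

binom : ℕ → ℤ → ℕ
binom a (+ b)    = a C b
binom a -[1+ b ] = 0

-- At (n , k , p) = (1 , 1 , 0) the formula for N-O n k p gives
-- 2 (binom 0 0 ^ 2 - 0) = 2, the sum being empty for k < 2. But paths of
-- length 1 have no interior point, so in fact:
N-O-1-1-0 : N-O 1 1 0ℤ ≡ 0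
N-O-1-1-0 = refl

{-# OPTIONS --safe #-}
-- Follow a pair of paths through its two x-coordinates (a , b); it meets when
-- a = b. A pair ending at total 2p + 1 with k interior meetings is cut at its
-- last meeting. What follows is a pair avoiding the diagonal, and by the
-- reflection principle there are as many of these as twice the pairs that are
-- one step shorter and both end at p. Hence N_O(n,k,p) is twice the number of
-- pairs of length n - 1 ending at (p , p) that meet at least k times after
-- time 0, the endpoint included. When n = 1 the endpoint is at time 0 and does
-- not count, whence the excluded triple. The cutting is done by induction on n,
-- for pairs of paths started at arbitrary a and b.
module Submission where

open import Defs
open import Data.Nat.Base using (ℕ; _>_; _∸_; _^_)
open import Data.Nat.ListAction using (sum)
open import Data.Integer.Base using (ℤ; +_; 0ℤ; _*_; _-_)
open import Data.List.Base using (map; upTo)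
open import Data.Product.Base using (_×_)
open import Relation.Binary.PropositionalEquality using (_≡_)
open import Relation.Nullary.Negation using (¬_)

open import Data.Bool.Base using (Bool; true; false; if_then_else_; _∧_)
open import Data.Bool.Properties using (∧-identityʳ; ∧-zeroʳ)
open import Data.Fin.Base as Fin using (Fin; toℕ)
open import Data.Fin.Properties using (toℕ-fromℕ)
open import Data.Integer.Base using (-[1+_]; 1ℤ; _+_; -_; ∣_∣)
import Data.Integer.Properties as ℤ
open import Algebra.Properties.AbelianGroup ℤ.+-0-abelianGroup using (∙-cancelʳ)
open import Data.Integer.Tactic.RingSolver using (solve-∀)
open import Data.List.Base
  using (List; []; _∷_; _++_; length; filter; cartesianProduct; applyUpTo; tabulate; allFin)
open import Data.Nat.Base as ℕ using (zero; suc; _≡ᵇ_; _<ᵇ_)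
open import Data.Nat.Combinatorics using (k>n⇒nCk≡0; nCk+nC[k+1]≡[n+1]C[k+1])
import Data.Nat.Properties as ℕ
open import Data.Product.Base using (_,_; proj₁)
open import Data.Vec.Base using ([]; _∷_)
open import Function.Base using (_∘_)
open import Function.Bundles using (mk⇔)
open import Relation.Binary.Definitions using (tri<; tri≈; tri>)
open import Relation.Binary.PropositionalEquality
  using (_≢_; refl; sym; trans; cong; cong₂; subst; ≢-sym; module ≡-Reasoning)
open import Relation.Nullary.Decidable using (does; yes; no; dec-true; dec-false; does-⇔)
open import Relation.Nullary.Negation using (contradiction)
open import Relation.Unary using (Decidable)

-- Weighted sums over pairs of paths of equal length.

⟦_⟧ : Bool → ℤ
⟦ b ⟧ = if b then 1ℤ else 0ℤ

pairSum : ∀ n → (Path n → Path n → ℤ) → ℤ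
pairSum zero    f = f [] []
pairSum (suc n) f =
  pairSum n (λ v w → f (E ∷ v) (E ∷ w)) + pairSum n (λ v w → f (E ∷ v) (N ∷ w)) +
  (pairSum n (λ v w → f (N ∷ v) (E ∷ w)) + pairSum n (λ v w → f (N ∷ v) (N ∷ w)))

pairSum-cong : ∀ n {f g} → (∀ v w → f v w ≡ g v w) → pairSum n f ≡ pairSum n g
pairSum-cong zero    f≗g = f≗g [] []
pairSum-cong (suc n) f≗g =
  cong₂ _+_
    (cong₂ _+_ (pairSum-cong n (λ _ _ → f≗g _ _)) (pairSum-cong n (λ _ _ → f≗g _ _)))
    (cong₂ _+_ (pairSum-cong n (λ _ _ → f≗g _ _)) (pairSum-cong n (λ _ _ → f≗g _ _)))

pairSum-0 : ∀ n → pairSum n (λ _ _ → 0ℤ) ≡ 0ℤ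
pairSum-0 zero    = refl
pairSum-0 (suc n) rewrite pairSum-0 n = refl

-- One simultaneous step of both paths, seen from their starts. The summands are grouped as in
-- `pairSum`, so that `free (suc n) f a b` is `spread (free n f) a b` by computation.
spread : (ℕ → ℕ → ℤ) → ℕ → ℕ → ℤ
spread f a b = f (suc a) (suc b) + f (suc a) b + (f a (suc b) + f a b)

spread-cong : ∀ {f g : ℕ → ℕ → ℤ} {a b} →
  f (suc a) (suc b) ≡ g (suc a) (suc b) → f (suc a) b ≡ g (suc a) b →
  f a (suc b) ≡ g a (suc b) → f a b ≡ g a b → spread f a b ≡ spread g a b
spread-cong ee en ne nn = cong₂ _+_ (cong₂ _+_ ee en) (cong₂ _+_ ne nn)

spread-double : ∀ {f g} → (∀ a b → f a b ≡ + 2 * g a b) →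
                ∀ a b → spread f a b ≡ + 2 * spread g a b
spread-double {g = g} f≡2g a b =
  trans (cong₂ _+_ (cong₂ _+_ (f≡2g _ _) (f≡2g _ _)) (cong₂ _+_ (f≡2g _ _) (f≡2g _ _)))
        (collect (g _ _) (g _ _) (g _ _) (g _ _))
  where
  collect : ∀ x y z t → + 2 * x + + 2 * y + (+ 2 * z + + 2 * t) ≡ + 2 * (x + y + (z + t))
  collect = solve-∀

-- Translated paths, their meetings, and weights at their ends.

eastward : Step → ℕ → ℕ
eastward E a = suc a
eastward N a = a

-- The x-coordinate after m steps of the path, translated to start at x = a.
at : ∀ {n} → ℕ → Path n → Fin (suc n) → ℕ
at a v       Fin.zero    = a
at a (s ∷ v) (Fin.suc m) = at (eastward s a) v m

end : ∀ {n} → ℕ → Path n → ℕ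
end a v = at a v (Fin.fromℕ _)

-- Meetings of the translated paths at times 0, …, n - 1: unlike in
-- intersections, time 0 counts.
visits : ∀ {n} → ℕ → ℕ → Path n → Path n → ℕ
visits a b []      []      = 0
visits a b (s ∷ v) (t ∷ w) =
  if a ≡ᵇ b then suc (visits (eastward s a) (eastward t b) v w)
            else visits (eastward s a) (eastward t b) v w

free : ∀ n → (ℕ → ℕ → ℤ) → ℕ → ℕ → ℤ
free n f a b = pairSum n (λ v w → f (end a v) (end b w))

free-antisym : ∀ {f} → (∀ a b → f a b ≡ - f b a) → ∀ n a b → free n f a b ≡ - free n f b a
free-antisym f-anti zero    a b = f-anti a b
free-antisym {f} f-anti (suc n) a b =
  trans (cong₂ _+_ (cong₂ _+_ (ih _ _) (ih _ _)) (cong₂ _+_ (ih _ _) (ih _ _)))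
        (rearrange (free n f _ _) (free n f _ _) (free n f _ _) (free n f _ _))
  where
  ih = free-antisym {f} f-anti n
  rearrange : ∀ x y z t → (- x + - y) + (- z + - t) ≡ - (x + z + (y + t))
  rearrange = solve-∀

-- `free n` is additive in the weight and commutes with translating either start and with exchanging
-- the two, so a linear relation between weights at the ends carries over to the starts.
free-shift : ∀ {f g} → (∀ a b → f (suc a) b - f a (suc b) ≡ g a b + g b a) →
             ∀ n a b → free n f (suc a) b - free n f a (suc b) ≡ free n g a b + free n g b a
free-shift fg zero    a b = fg a b
free-shift {f} {g} fg (suc n) a b =
  trans (regroup (F _ _) (F _ _) (F _ _) (F _ _) (F _ _) (F _ _) (F _ _) (F _ _))
  (trans (cong₂ _+_ (cong₂ _+_ (ih (suc a) (suc b)) (ih (suc a) b)) (cong₂ _+_ (ih a (suc b)) (ih a b)))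
  (pairUp (G _ _) (G _ _) (G _ _) (G _ _) (G _ _) (G _ _) (G _ _) (G _ _)))
  where
  F = free n f
  G = free n g
  ih = free-shift {f} {g} fg n
  regroup : ∀ x₁ x₂ x₃ x₄ y₁ y₂ y₃ y₄ →
    (x₁ + x₂ + (x₃ + x₄)) - (y₁ + y₂ + (y₃ + y₄)) ≡
    (x₁ - y₁ + (x₂ - y₂)) + ((x₃ - y₃) + (x₄ - y₄))
  regroup = solve-∀
  pairUp : ∀ x₁ x₂ x₃ x₄ y₁ y₂ y₃ y₄ →
    ((x₁ + y₁) + (x₂ + y₂)) + ((x₃ + y₃) + (x₄ + y₄)) ≡
    (x₁ + x₂ + (x₃ + x₄)) + (y₁ + y₃ + (y₂ + y₄))
  pairUp = solve-∀

-- Boolean comparisons and parity.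

≡ᵇ-true : ∀ {a b} → a ≡ b → (a ≡ᵇ b) ≡ true
≡ᵇ-true = dec-true (_ ℕ.≟ _)

≡ᵇ-false : ∀ {a b} → a ≢ b → (a ≡ᵇ b) ≡ false
≡ᵇ-false = dec-false (_ ℕ.≟ _)

<ᵇ-true : ∀ {a b} → a ℕ.< b → (a <ᵇ b) ≡ true
<ᵇ-true = dec-true (_ ℕ.<? _)

<ᵇ-false : ∀ {a b} → b ℕ.≤ a → (a <ᵇ b) ≡ false
<ᵇ-false b≤a = dec-false (_ ℕ.<? _) (ℕ.≤⇒≯ b≤a)

double≢odd : ∀ x p → x + x ≢ + 2 * p + 1ℤ
double≢odd x p eq = ℕ.even≢odd ∣ x - p ∣ 0
  (trans (sym (ℤ.abs-* (+ 2) (x - p))) (cong ∣_∣ 2[x-p]≡1))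
  where
  split : ∀ x p → + 2 * (x - p) ≡ (x + x) - + 2 * p
  split = solve-∀
  cancel : ∀ p → + 2 * p + 1ℤ - + 2 * p ≡ 1ℤ
  cancel = solve-∀
  2[x-p]≡1 : + 2 * (x - p) ≡ 1ℤ
  2[x-p]≡1 = trans (split x p) (trans (cong (_- + 2 * p) eq) (cancel p))

x≡-x⇒x≡0 : ∀ x → x ≡ - x → x ≡ 0ℤ
x≡-x⇒x≡0 (+ zero) _ = refl
x≡-x⇒x≡0 (+ suc _) ()
x≡-x⇒x≡0 -[1+ _ ] ()

-- Reflection, and cutting at the last meeting.

module _ (p : ℤ) where

  sumsToOdd : ℕ → Bool
  sumsToOdd c = does (+ c ℤ.≟ + 2 * p + 1ℤ)

  isTarget : ℕ → Bool
  isTarget a = does (+ a ℤ.≟ p)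

  bridge : ℕ → ℕ → Bool
  bridge a b = isTarget a ∧ isTarget b

  diagonal-even : ∀ c → sumsToOdd (c ℕ.+ c) ≡ false
  diagonal-even c = dec-false (_ ℤ.≟ _) (double≢odd (+ c) p)

  -- Since (a + 1) + a = 2a + 1, the total of two adjacent ends determines the lower one. Here the
  -- total 2p + 1 turns into the single target `p`.
  sumsToOdd-suc : ∀ a → sumsToOdd (suc a ℕ.+ a) ≡ isTarget a
  sumsToOdd-suc a with + a ℤ.≟ p
  ... | yes refl = dec-true (_ ℤ.≟ _) (arith p)
    where
    arith : ∀ q → 1ℤ + (q + q) ≡ + 2 * q + 1ℤ
    arith = solve-∀
  ... | no a≢p   = dec-false (_ ℤ.≟ _) λ eq → a≢p (ℤ.*-cancelˡ-≡ (+ 2) (+ a) p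
                     (∙-cancelʳ 1ℤ (+ 2 * + a) (+ 2 * p) (trans (arith (+ a)) eq)))
    where
    arith : ∀ q → + 2 * q + 1ℤ ≡ 1ℤ + (q + q)
    arith = solve-∀

  bridge-diag : ∀ a → bridge a a ≡ isTarget a
  bridge-diag a with isTarget a
  ... | true  = refl
  ... | false = refl

  bridge-off : ∀ {a b} → a ≢ b → bridge a b ≡ false
  bridge-off {a} {b} a≢b with + a ℤ.≟ p | + b ℤ.≟ p
  ... | yes refl | yes b≡a = contradiction (sym (ℤ.+-injective b≡a)) a≢b
  ... | yes refl | no  _   = refl
  ... | no  _    | _       = refl

  -- With `a` equal to `suc b` the total would be the even number 2(b + 1).
  odd⇒≢suc : ∀ a b → (sumsToOdd (suc a ℕ.+ b) ≡ true) → a ≢ suc b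
  odd⇒≢suc a b odd refl with () ← trans (sym odd)
    (trans (cong sumsToOdd (cong suc (sym (ℕ.+-suc b b)))) (diagonal-even (suc b)))

  -- Under free, this weight counts with the sign of a - b the pairs that end at
  -- total 2p + 1, whether or not they meet. Antisymmetry makes all pairs that
  -- meet cancel: this is the reflection principle.
  signed : ℕ → ℕ → ℤ
  signed a b = ⟦ (b <ᵇ a) ∧ sumsToOdd (a ℕ.+ b) ⟧ - ⟦ (a <ᵇ b) ∧ sumsToOdd (a ℕ.+ b) ⟧

  bridges : ℕ → ℕ → ℤ
  bridges a b = ⟦ bridge a b ⟧

  signed-antisym : ∀ a b → signed a b ≡ - signed b a
  signed-antisym a b rewrite ℕ.+-comm a b =
    flip ⟦ (b <ᵇ a) ∧ sumsToOdd (b ℕ.+ a) ⟧ _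
    where
    flip : ∀ x y → x - y ≡ - (y - x)
    flip = solve-∀

  -- Both signed terms have total a + b + 1. If a = b, their signs are opposite and the total is odd
  -- as required exactly when a = p, which gives 2. If a and b differ by at least 2, the signs
  -- agree; if they differ by 1, the total is even and both terms vanish.
  signed-shift : ∀ a b → signed (suc a) b - signed a (suc b) ≡ bridges a b + bridges b a
  signed-shift a b rewrite ℕ.+-suc a b with ℕ.<-cmp a b
  ... | tri≈ _ refl _ rewrite <ᵇ-true (ℕ.n<1+n a) | <ᵇ-false (ℕ.n≤1+n a)
                    | sumsToOdd-suc a | bridge-diag a with isTarget a
  ...   | true  = refl
  ...   | false = refl
  signed-shift a b | tri< a<b a≢b _
    rewrite bridge-off a≢b | bridge-off (≢-sym a≢b)
          | <ᵇ-false {b} {suc a} a<b | <ᵇ-true {a} {suc b} (ℕ.m<n⇒m<1+n a<b)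
          | <ᵇ-false {suc b} {a} (ℕ.<⇒≤ (ℕ.m<n⇒m<1+n a<b))
    with sumsToOdd (suc a ℕ.+ b) in odd
  ...   | false rewrite ∧-zeroʳ (suc a <ᵇ b) = refl
  ...   | true
    rewrite <ᵇ-true {suc a} {b} (ℕ.≤∧≢⇒< a<b (≢-sym (odd⇒≢suc b a
              (trans (cong (sumsToOdd ∘ suc) (ℕ.+-comm b a)) odd)))) = refl
  signed-shift a b | tri> _ a≢b b<a
    rewrite bridge-off a≢b | bridge-off (≢-sym a≢b)
          | <ᵇ-false {a} {suc b} b<a | <ᵇ-true {b} {suc a} (ℕ.m<n⇒m<1+n b<a)
          | <ᵇ-false {suc a} {b} (ℕ.<⇒≤ (ℕ.m<n⇒m<1+n b<a))
    with sumsToOdd (suc a ℕ.+ b) in odd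
  ...   | false rewrite ∧-zeroʳ (suc b <ᵇ a) = refl
  ...   | true
    rewrite <ᵇ-true {suc b} {a} (ℕ.≤∧≢⇒< b<a (≢-sym (odd⇒≢suc a b odd))) = refl

  -- Ends with an odd total are distinct, so here `visits` misses no meeting by ignoring the end.
  Z : ∀ n → ℕ → ℕ → ℕ → ℤ
  Z n k a b = pairSum n λ v w → ⟦ (visits a b v w ≡ᵇ k) ∧ sumsToOdd (end a v ℕ.+ end b w) ⟧

  -- The end of a bridge is a meeting that visits does not count, so
  -- j ≤ visits says that there are at least j + 1 meetings.
  Y : ∀ n → ℕ → ℕ → ℕ → ℤ
  Y n j a b = pairSum n λ v w → ⟦ (j <ᵇ suc (visits a b v w)) ∧ bridge (end a v) (end b w) ⟧

  Z-off : ∀ n k {a b} → a ≢ b → Z (suc n) k a b ≡ spread (Z n k) a b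
  Z-off n k a≢b rewrite ≡ᵇ-false a≢b = refl

  Z-diag : ∀ n k a → Z (suc n) (suc k) a a ≡ spread (Z n k) a a
  Z-diag n k a rewrite ≡ᵇ-true {a} refl = refl

  -- Equal starts are a visit at time 0. For length 0, where no time is counted, parity of the total
  -- excludes the pair instead.
  Z₀-diag : ∀ n a → Z n 0 a a ≡ 0ℤ
  Z₀-diag zero    a = cong ⟦_⟧ (diagonal-even a)
  Z₀-diag (suc n) a rewrite ≡ᵇ-true {a} refl = pairSum-0 (suc n)

  Y-off : ∀ n j {a b} → a ≢ b → Y (suc n) j a b ≡ spread (Y n j) a b
  Y-off n j a≢b rewrite ≡ᵇ-false a≢b = refl

  Y-diag : ∀ n j a → Y (suc n) (suc j) a a ≡ spread (Y n j) a a
  Y-diag n j a rewrite ≡ᵇ-true {a} refl = refl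

  Z-sym : ∀ n k a b → Z n k a b ≡ Z n k b a
  Z-sym zero    k a b = cong (λ c → ⟦ (0 ≡ᵇ k) ∧ sumsToOdd c ⟧) (ℕ.+-comm a b)
  Z-sym (suc n) k a b with a ℕ.≟ b
  ... | yes refl = refl
  ... | no  a≢b  = begin
    Z (suc n) k a b
      ≡⟨ Z-off n k a≢b ⟩
    spread (Z n k) a b
      ≡⟨ spread-cong {Z n k} {λ x y → Z n k y x}
           (Z-sym n k _ _) (Z-sym n k _ _) (Z-sym n k _ _) (Z-sym n k _ _) ⟩
    spread (λ x y → Z n k y x) a b
      ≡⟨ swap (Z n k _ _) (Z n k _ _) (Z n k _ _) (Z n k _ _) ⟩
    spread (Z n k) b a
      ≡⟨ Z-off n k (≢-sym a≢b) ⟨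
    Z (suc n) k b a ∎
    where
    open ≡-Reasoning
    swap : ∀ x y z t → x + y + (z + t) ≡ x + z + (y + t)
    swap = solve-∀

  -- Both sides obey the same recurrence off the diagonal and vanish on it, the right one by
  -- antisymmetry. One step changes a - b by at most 1, so a pair with b < a cannot cross the
  -- diagonal without landing on it, and a pair that never meets keeps the sign +1.
  Z₀≡signed : ∀ n {a b} → b ℕ.≤ a → Z n 0 a b ≡ free n signed a b
  Z₀≡signed n {a} {b} b≤a with a ℕ.≟ b
  Z₀≡signed n {a} b≤a | yes refl =
    trans (Z₀-diag n a) (sym (x≡-x⇒x≡0 _ (free-antisym {signed} signed-antisym n a a)))
  Z₀≡signed zero    {a} {b} b≤a | no a≢b
    rewrite <ᵇ-true {b} {a} (ℕ.≤∧≢⇒< b≤a (≢-sym a≢b)) | <ᵇ-false {a} {b} b≤a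
    = sym (ℤ.+-identityʳ _)
  Z₀≡signed (suc n) {a} {b} b≤a | no a≢b =
    trans (Z-off n 0 a≢b) (spread-cong {Z n 0} {free n signed}
      (Z₀≡signed n (ℕ.s≤s b≤a)) (Z₀≡signed n (ℕ.m≤n⇒m≤1+n b≤a))
      (Z₀≡signed n (ℕ.≤∧≢⇒< b≤a (≢-sym a≢b))) (Z₀≡signed n b≤a))

  -- The only visit is the common start, so the rest of the pair avoids the diagonal. Reflection
  -- makes the two mixed first steps a difference of signed counts, and `free-shift` converts it
  -- into bridges that are one step shorter.
  Z₁-diag : ∀ n a → Z (suc n) 1 a a ≡ + 2 * free n bridges a a
  Z₁-diag n a = begin
    Z (suc n) 1 a a                     ≡⟨ Z-diag n 0 a ⟩
    -- Equal first steps would lead to a second meeting, so the outer two terms vanish.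
    spread (Z n 0) a a                  ≡⟨ cong₂ _+_ (cong₂ _+_ (Z₀-diag n (suc a)) above) (cong₂ _+_ below (Z₀-diag n a)) ⟩
    (0ℤ + W (suc a) a) + (- W a (suc a) + 0ℤ)
                                        ≡⟨ tidy (W (suc a) a) (W a (suc a)) ⟩
    W (suc a) a - W a (suc a)           ≡⟨ free-shift {signed} {bridges} signed-shift n a a ⟩
    B + B                               ≡⟨ double B ⟩
    + 2 * B                             ∎
    where
    open ≡-Reasoning
    W = free n signed
    B = free n bridges a a
    above : Z n 0 (suc a) a ≡ W (suc a) a
    above = Z₀≡signed n (ℕ.n≤1+n a)
    below : Z n 0 a (suc a) ≡ - W a (suc a)
    below = trans (Z-sym n 0 a (suc a)) (trans above (free-antisym {signed} signed-antisym n (suc a) a))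
    tidy : ∀ x y → (0ℤ + x) + (- y + 0ℤ) ≡ x - y
    tidy = solve-∀
    double : ∀ x → x + x ≡ + 2 * x
    double = solve-∀

  -- Both sides obey the same recurrence. Each meeting at the start lowers both indices by one,
  -- until `j` is 0 and the present meeting is the last one, where the pair is cut.
  Z≡2Y : ∀ n j a b → Z (suc n) (suc j) a b ≡ + 2 * Y n j a b
  Z≡2Y n j a b with a ℕ.≟ b
  -- `Y n 0 a a` computes to `free n bridges a a`, because `0 <ᵇ suc _` is `true`.
  Z≡2Y n       zero    a b | yes refl = Z₁-diag n a
  Z≡2Y zero    (suc j) a b | yes refl = Z-diag zero (suc j) a
  -- Both sides are 0: the left has no visit, and on the right distinct starts of length 0 form no
  -- bridge.
  Z≡2Y zero    j       a b | no a≢b   =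
    trans (Z-off zero (suc j) a≢b)
      (cong (+ 2 *_) (sym (cong ⟦_⟧ (trans (cong ((j <ᵇ 1) ∧_) (bridge-off a≢b)) (∧-zeroʳ (j <ᵇ 1))))))
  Z≡2Y (suc n) (suc j) a b | yes refl =
    trans (Z-diag (suc n) (suc j) a)
      (trans (spread-double (Z≡2Y n j) a a) (cong (+ 2 *_) (sym (Y-diag n j a))))
  Z≡2Y (suc n) j       a b | no a≢b   =
    trans (Z-off (suc n) (suc j) a≢b)
      (trans (spread-double (Z≡2Y n j) a b) (cong (+ 2 *_) (sym (Y-off n j a≢b))))

-- Finite sums over lists, and their passage to sums over pairs of paths.

∑ : ∀ {A : Set} → List A → (A → ℤ) → ℤ
∑ []       f = 0ℤ
∑ (x ∷ xs) f = f x + ∑ xs f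

∑-cong : ∀ {A : Set} (xs : List A) {f g : A → ℤ} → (∀ x → f x ≡ g x) → ∑ xs f ≡ ∑ xs g
∑-cong []       f≗g = refl
∑-cong (x ∷ xs) f≗g = cong₂ _+_ (f≗g x) (∑-cong xs f≗g)

∑-++ : ∀ {A : Set} (xs ys : List A) f → ∑ (xs ++ ys) f ≡ ∑ xs f + ∑ ys f
∑-++ []       ys f = sym (ℤ.+-identityˡ _)
∑-++ (x ∷ xs) ys f = trans (cong (_+_ (f x)) (∑-++ xs ys f)) (sym (ℤ.+-assoc (f x) _ _))

∑-map : ∀ {A B : Set} (h : A → B) xs f → ∑ (map h xs) f ≡ ∑ xs (f ∘ h)
∑-map h []       f = refl
∑-map h (x ∷ xs) f = cong (_+_ (f (h x))) (∑-map h xs f)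

∑-applyUpTo : ∀ {A : Set} (h : ℕ → A) n f → ∑ (applyUpTo h n) f ≡ ∑ (upTo n) (f ∘ h)
∑-applyUpTo h zero    f = refl
∑-applyUpTo h (suc n) f =
  cong (_+_ (f (h 0))) (trans (∑-applyUpTo (h ∘ suc) n f) (sym (∑-applyUpTo suc n (f ∘ h))))

∑-tabulate : ∀ {A : Set} n (h : Fin n → A) f → ∑ (tabulate h) f ≡ ∑ (allFin n) (f ∘ h)
∑-tabulate zero    h f = refl
∑-tabulate (suc n) h f =
  cong (_+_ (f (h Fin.zero))) (trans (∑-tabulate n (h ∘ Fin.suc) f) (sym (∑-tabulate n Fin.suc (f ∘ h))))

∑-0 : ∀ {A : Set} (xs : List A) → ∑ xs (λ _ → 0ℤ) ≡ 0ℤ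
∑-0 []       = refl
∑-0 (x ∷ xs) = trans (ℤ.+-identityˡ _) (∑-0 xs)

interchange : ∀ x y z t → (x + y) + (z + t) ≡ (x + z) + (y + t)
interchange = solve-∀

∑-+ : ∀ {A : Set} (xs : List A) f g → ∑ xs (λ x → f x + g x) ≡ ∑ xs f + ∑ xs g
∑-+ []       f g = refl
∑-+ (x ∷ xs) f g = trans (cong (_+_ (f x + g x)) (∑-+ xs f g)) (interchange (f x) (g x) (∑ xs f) (∑ xs g))

∑-cartesianProduct : ∀ {A B : Set} (xs : List A) (ys : List B) f →
  ∑ (cartesianProduct xs ys) f ≡ ∑ xs (λ x → ∑ ys (λ y → f (x , y)))
∑-cartesianProduct []       ys f = refl
∑-cartesianProduct (x ∷ xs) ys f =
  trans (∑-++ (map (x ,_) ys) _ f)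
        (cong₂ _+_ (∑-map (x ,_) ys f) (∑-cartesianProduct xs ys f))

∑-filter : ∀ {A : Set} {P : A → Set} (P? : Decidable P) xs f →
  ∑ (filter P? xs) f ≡ ∑ xs (λ x → if does (P? x) then f x else 0ℤ)
∑-filter P? []       f = refl
∑-filter P? (x ∷ xs) f with does (P? x)
... | true  = cong (_+_ (f x)) (∑-filter P? xs f)
... | false = trans (∑-filter P? xs f) (sym (ℤ.+-identityˡ _))

length-∑ : ∀ {A : Set} (xs : List A) → + length xs ≡ ∑ xs (λ _ → 1ℤ)
length-∑ []       = refl
length-∑ (x ∷ xs) = cong (_+_ 1ℤ) (length-∑ xs)

length-filter-∑ : ∀ {A : Set} {P : A → Set} (P? : Decidable P) xs →
  + length (filter P? xs) ≡ ∑ xs (λ x → ⟦ does (P? x) ⟧)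
length-filter-∑ P? xs = trans (length-∑ (filter P? xs)) (∑-filter P? xs (λ _ → 1ℤ))

sum-∑ : ∀ {A : Set} (f : A → ℕ) xs → + sum (map f xs) ≡ ∑ xs (λ x → + f x)
sum-∑ f []       = refl
sum-∑ f (x ∷ xs) = cong (_+_ (+ f x)) (sum-∑ f xs)

-- Serves both to collapse the sum over end coordinates and, with `g` constant, to merge the
-- conditions "exactly i meetings" into a single bound.
∑-sift : ∀ n x (g : ℕ → ℤ) →
  ∑ (upTo n) (λ i → if x ≡ᵇ i then g i else 0ℤ) ≡ (if x <ᵇ n then g x else 0ℤ)
∑-sift zero    x       g = refl
∑-sift (suc n) zero    g =
  trans (cong (_+_ (g 0)) (trans (∑-applyUpTo suc n _) (∑-0 (upTo n)))) (ℤ.+-identityʳ _)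
∑-sift (suc n) (suc x) g =
  trans (ℤ.+-identityˡ _) (trans (∑-applyUpTo suc n _) (∑-sift n x (g ∘ suc)))

∑-paths : ∀ n f → ∑ (paths (suc n)) f ≡
  ∑ (paths n) (λ v → f (E ∷ v)) + ∑ (paths n) (λ v → f (N ∷ v))
∑-paths n f = trans (∑-++ (map (E ∷_) (paths n)) _ f)
  (cong₂ _+_ (∑-map _ (paths n) f)
    (trans (∑-++ (map (N ∷_) (paths n)) [] f)
      (trans (ℤ.+-identityʳ _) (∑-map _ (paths n) f))))

∑-paths² : ∀ n f → ∑ (paths n) (λ v → ∑ (paths n) (f v)) ≡ pairSum n f
∑-paths² zero    f = trans (ℤ.+-identityʳ _) (ℤ.+-identityʳ _)
∑-paths² (suc n) f = trans (∑-paths n (λ v → ∑ (paths (suc n)) (f v))) (cong₂ _+_ (half E) (half N))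
  where
  half : ∀ s → ∑ (paths n) (λ v → ∑ (paths (suc n)) (f (s ∷ v))) ≡
               pairSum n (λ v w → f (s ∷ v) (E ∷ w)) + pairSum n (λ v w → f (s ∷ v) (N ∷ w))
  half s = trans (∑-cong (paths n) (λ v → ∑-paths n (f (s ∷ v))))
    (trans (∑-+ (paths n) _ _) (cong₂ _+_ (∑-paths² n _) (∑-paths² n _)))

pairSum-+ : ∀ n f g → pairSum n (λ v w → f v w + g v w) ≡ pairSum n f + pairSum n g
pairSum-+ n f g = begin
  pairSum n (λ v w → f v w + g v w)
    ≡⟨ ∑-paths² n _ ⟨
  ∑ (paths n) (λ v → ∑ (paths n) (λ w → f v w + g v w))
    ≡⟨ ∑-cong (paths n) (λ v → ∑-+ (paths n) (f v) (g v)) ⟩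
  ∑ (paths n) (λ v → ∑ (paths n) (f v) + ∑ (paths n) (g v))
    ≡⟨ ∑-+ (paths n) _ _ ⟩
  ∑ (paths n) (λ v → ∑ (paths n) (f v)) + ∑ (paths n) (λ v → ∑ (paths n) (g v))
    ≡⟨ cong₂ _+_ (∑-paths² n f) (∑-paths² n g) ⟩
  pairSum n f + pairSum n g ∎
  where open ≡-Reasoning

pairSum-∑ : ∀ {A : Set} n (xs : List A) (f : A → Path n → Path n → ℤ) →
  ∑ xs (λ x → pairSum n (f x)) ≡ pairSum n (λ v w → ∑ xs (λ x → f x v w))
pairSum-∑ n []       f = sym (pairSum-0 n)
pairSum-∑ n (x ∷ xs) f = trans (cong (_+_ (pairSum n (f x))) (pairSum-∑ n xs f)) (sym (pairSum-+ n (f x) _))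

-- Positions and intersections in terms of x-coordinates.

position-at : ∀ {n} a (v : Path n) m →
  position v m ≡ (+ at a v m - + a , + toℕ m - (+ at a v m - + a))
position-at a v Fin.zero = cong₂ _,_ (sym (ℤ.+-inverseʳ (+ a))) (cong (λ x → 0ℤ - x) (sym (ℤ.+-inverseʳ (+ a))))
position-at a (E ∷ v) (Fin.suc m) rewrite position-at (suc a) v m =
  cong₂ _,_ (east (+ at (suc a) v m) (+ a)) (north (+ at (suc a) v m) (+ a) (+ toℕ m))
  where
  east : ∀ x a → 1ℤ + (x - (1ℤ + a)) ≡ x - a
  east = solve-∀
  north : ∀ x a m → 0ℤ + (m - (x - (1ℤ + a))) ≡ 1ℤ + m - (x - a)
  north = solve-∀
position-at a (N ∷ v) (Fin.suc m) rewrite position-at a v m =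
  cong₂ _,_ (ℤ.+-identityˡ _) (sym (ℤ.+-assoc 1ℤ (+ toℕ m) (- (+ at a v m - + a))))

position-at₀ : ∀ {n} (v : Path n) m → position v m ≡ (+ at 0 v m , + toℕ m - + at 0 v m)
position-at₀ v m = trans (position-at 0 v m)
  (cong (λ x → x , + toℕ m - x) (ℤ.+-identityʳ _))

-- The y-coordinate is the time minus the x-coordinate, so at equal times the x-coordinates decide.
does-position : ∀ {n} (v w : Path n) m →
  does (position v m ≟ₚ position w m) ≡ (at 0 v m ≡ᵇ at 0 w m)
does-position v w m = does-⇔
  (mk⇔ (λ eq → ℤ.+-injective (cong proj₁ (trans (sym (position-at₀ v m)) (trans eq (position-at₀ w m)))))
       (λ eq → trans (position-at₀ v m) (trans (cong (λ x → + x , + toℕ m - + x) eq) (sym (position-at₀ w m)))))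
  (position v m ≟ₚ position w m) (at 0 v m ℕ.≟ at 0 w m)

does-endpoint : ∀ {n} (v : Path n) r →
  does (endpoint v ≟ₚ (r , + n - r)) ≡ does (+ end 0 v ℤ.≟ r)
does-endpoint {n} v r = does-⇔
  (mk⇔ (λ eq → cong proj₁ (trans (sym endpoint-end) eq))
       (λ eq → trans endpoint-end (cong (λ x → x , + n - x) eq)))
  (endpoint v ≟ₚ (r , + n - r)) (+ end 0 v ℤ.≟ r)
  where
  endpoint-end : endpoint v ≡ (+ end 0 v , + n - + end 0 v)
  endpoint-end = trans (position-at₀ v (Fin.fromℕ n))
    (cong (λ m → + end 0 v , + m - + end 0 v) (toℕ-fromℕ n))

visits-∑ : ∀ {n} a b (v w : Path n) → + visits a b v w ≡
  ∑ (allFin (suc n)) (λ m → ⟦ (toℕ m <ᵇ n) ∧ (at a v m ≡ᵇ at b w m) ⟧)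
visits-∑ a b [] [] = refl
visits-∑ {suc n} a b (s ∷ v) (t ∷ w) = begin
  + visits a b (s ∷ v) (t ∷ w)
    ≡⟨ count (a ≡ᵇ b) ⟩
  ⟦ a ≡ᵇ b ⟧ + + visits (eastward s a) (eastward t b) v w
    ≡⟨ cong (_+_ (⟦ a ≡ᵇ b ⟧)) (visits-∑ (eastward s a) (eastward t b) v w) ⟩
  ⟦ a ≡ᵇ b ⟧ + ∑ (allFin (suc n)) (term ∘ Fin.suc)
    ≡⟨ cong (_+_ (⟦ a ≡ᵇ b ⟧)) (∑-tabulate (suc n) Fin.suc term) ⟨
  ∑ (allFin (suc (suc n))) term ∎
  where
  open ≡-Reasoning
  term : Fin (suc (suc n)) → ℤ
  term m = ⟦ (toℕ m <ᵇ suc n) ∧ (at a (s ∷ v) m ≡ᵇ at b (t ∷ w) m) ⟧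
  count : ∀ c {x} → + (if c then suc x else x) ≡ ⟦ c ⟧ + + x
  count true  = refl
  count false = refl

-- `visits` counts the common start, which `intersections` leaves out; from time 1 on the two tests
-- agree. Positive length is essential: at length 0 both counts are 0.
visits≡1+intersections : ∀ {n} (v w : Path (suc n)) → visits 0 0 v w ≡ suc (intersections v w)
visits≡1+intersections {n} (s ∷ v) (t ∷ w) = cong suc (ℤ.+-injective (begin
  + visits (eastward s 0) (eastward t 0) v w
    ≡⟨ visits-∑ _ _ v w ⟩
  ∑ (allFin (suc n)) (λ m → ⟦ (toℕ m <ᵇ n) ∧ (at _ v m ≡ᵇ at _ w m) ⟧)
    ≡⟨ ∑-cong (allFin (suc n)) (λ m → cong (λ c → ⟦ (toℕ m <ᵇ n) ∧ c ⟧)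
         (sym (does-position (s ∷ v) (t ∷ w) (Fin.suc m)))) ⟩
  ∑ (allFin (suc n)) (term ∘ Fin.suc)
    ≡⟨ ∑-tabulate (suc n) Fin.suc term ⟨
  ∑ (tabulate Fin.suc) term
    -- The summand at time 0 computes to 0, since `MeetsAt` demands a time of at least 1.
    ≡⟨ ℤ.+-identityˡ _ ⟨
  ∑ (allFin (suc (suc n))) term
    ≡⟨ length-filter-∑ (meetsAt? (s ∷ v) (t ∷ w)) (allFin (suc (suc n))) ⟨
  + intersections (s ∷ v) (t ∷ w) ∎))
  where
  open ≡-Reasoning
  term : Fin (suc (suc n)) → ℤ
  term m = ⟦ does (meetsAt? (s ∷ v) (t ∷ w) m) ⟧

-- `M` and `N-O` as sums over pairs of paths.

M-pairSum : ∀ n k r s → + M n k r s ≡ pairSum n λ v w →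
  ⟦ does (+ end 0 v ℤ.≟ r) ∧ does (+ end 0 w ℤ.≟ s) ∧ (intersections v w ≡ᵇ k) ⟧
M-pairSum n k r s = begin
  + M n k r s
    ≡⟨ length-filter-∑ (admissible? n k r s) (cartesianProduct (paths n) (paths n)) ⟩
  ∑ (cartesianProduct (paths n) (paths n)) (λ vw → ⟦ does (admissible? n k r s vw) ⟧)
    ≡⟨ ∑-cartesianProduct (paths n) (paths n) (λ vw → ⟦ does (admissible? n k r s vw) ⟧) ⟩
  ∑ (paths n) (λ v → ∑ (paths n) (λ w → ⟦ does (admissible? n k r s (v , w)) ⟧))
    ≡⟨ ∑-paths² n _ ⟩
  pairSum n (λ v w → ⟦ does (admissible? n k r s (v , w)) ⟧)
    ≡⟨ pairSum-cong n (λ v w → cong₂ (λ x y → ⟦ x ∧ y ∧ (intersections v w ≡ᵇ k) ⟧)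
         (does-endpoint v r) (does-endpoint w s)) ⟩
  _ ∎
  where open ≡-Reasoning

end≤ : ∀ {n} a (v : Path n) → end a v ℕ.≤ n ℕ.+ a
end≤ a []               = ℕ.≤-refl
end≤ {suc n} a (E ∷ v) = subst (end (suc a) v ℕ.≤_) (ℕ.+-suc n a) (end≤ (suc a) v)
end≤ a (N ∷ v)          = ℕ.m≤n⇒m≤1+n (end≤ a v)

∑-if : ∀ {A : Set} (xs : List A) c f →
  ∑ xs (λ x → if c then f x else 0ℤ) ≡ (if c then ∑ xs f else 0ℤ)
∑-if xs true  f = refl
∑-if xs false f = ∑-0 xs

-- For fixed paths only (r , s) = (x , y) can contribute; the two bounds place it in the box that
-- `oddPairs` enumerates.
∑-oddPairs : ∀ n p {x y} c → x ℕ.≤ n → y ℕ.≤ n →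
  ∑ (oddPairs n p) (λ (r , s) → ⟦ does (+ x ℤ.≟ r) ∧ does (+ y ℤ.≟ s) ∧ c ⟧) ≡
  ⟦ c ∧ sumsToOdd p (x ℕ.+ y) ⟧
∑-oddPairs n p {x} {y} c x≤n y≤n =
  trans (∑-filter (λ (r , s) → r + s ℤ.≟ + 2 * p + 1ℤ) (cartesianProduct (range (suc n)) (range (suc n))) _)
        (sift² (suc n) (ℕ.s≤s x≤n) (ℕ.s≤s y≤n))
  where
  range : ℕ → List ℤ
  range m = map +_ (upTo m)
  nest : ∀ q a b c → (if q then ⟦ a ∧ b ∧ c ⟧ else 0ℤ) ≡
                     (if a then (if b then ⟦ c ∧ q ⟧ else 0ℤ) else 0ℤ)
  nest true  true  true  c rewrite ∧-identityʳ c = refl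
  nest false true  true  c rewrite ∧-zeroʳ c = refl
  nest true  true  false _ = refl
  nest true  false _     _ = refl
  nest false true  false _ = refl
  nest false false _     _ = refl

  -- A variable bound `m` keeps `upTo m` from unfolding, as `upTo (suc n)` would.
  sift² : ∀ m → x ℕ.< m → y ℕ.< m →
    ∑ (cartesianProduct (range m) (range m)) (λ (r , s) → if does (r + s ℤ.≟ + 2 * p + 1ℤ)
      then ⟦ does (+ x ℤ.≟ r) ∧ does (+ y ℤ.≟ s) ∧ c ⟧ else 0ℤ) ≡ ⟦ c ∧ sumsToOdd p (x ℕ.+ y) ⟧
  sift² m x<m y<m = begin
    ∑ (cartesianProduct (range m) (range m)) term
      ≡⟨ ∑-cartesianProduct (range m) (range m) term ⟩
    ∑ (range m) (λ r → ∑ (range m) (λ s → term (r , s)))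
      ≡⟨ ∑-map +_ (upTo m) _ ⟩
    ∑ (upTo m) (λ a → ∑ (range m) (λ s → term (+ a , s)))
      ≡⟨ ∑-cong (upTo m) (λ a → trans (∑-map +_ (upTo m) _)
           (trans (∑-cong (upTo m) (λ b → nest (sumsToOdd p (a ℕ.+ b)) (x ≡ᵇ a) (y ≡ᵇ b) c))
                  (∑-if (upTo m) (x ≡ᵇ a) _))) ⟩
    ∑ (upTo m) (λ a → if x ≡ᵇ a then row a else 0ℤ)
      ≡⟨ ∑-sift m x row ⟩
    (if x <ᵇ m then row x else 0ℤ)
      ≡⟨ cong (λ i → if i then row x else 0ℤ) (<ᵇ-true x<m) ⟩
    row x
      ≡⟨ ∑-sift m y _ ⟩
    (if y <ᵇ m then ⟦ c ∧ sumsToOdd p (x ℕ.+ y) ⟧ else 0ℤ)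
      ≡⟨ cong (λ i → if i then ⟦ c ∧ sumsToOdd p (x ℕ.+ y) ⟧ else 0ℤ) (<ᵇ-true y<m) ⟩
    ⟦ c ∧ sumsToOdd p (x ℕ.+ y) ⟧ ∎
    where
    open ≡-Reasoning
    term : ℤ × ℤ → ℤ
    term (r , s) = if does (r + s ℤ.≟ + 2 * p + 1ℤ)
                   then ⟦ does (+ x ℤ.≟ r) ∧ does (+ y ℤ.≟ s) ∧ c ⟧ else 0ℤ
    row : ℕ → ℤ
    row a = ∑ (upTo m) (λ b → if y ≡ᵇ b then ⟦ c ∧ sumsToOdd p (a ℕ.+ b) ⟧ else 0ℤ)

N-O-pairSum : ∀ n k p → + N-O n k p ≡ pairSum n λ v w →
  ⟦ (intersections v w ≡ᵇ k) ∧ sumsToOdd p (end 0 v ℕ.+ end 0 w) ⟧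
N-O-pairSum n k p = begin
  + N-O n k p
    ≡⟨ sum-∑ (λ (r , s) → M n k r s) (oddPairs n p) ⟩
  ∑ (oddPairs n p) (λ (r , s) → + M n k r s)
    ≡⟨ ∑-cong (oddPairs n p) (λ (r , s) → M-pairSum n k r s) ⟩
  ∑ (oddPairs n p) (λ rs → pairSum n (term rs))
    ≡⟨ pairSum-∑ n (oddPairs n p) term ⟩
  pairSum n (λ v w → ∑ (oddPairs n p) (λ rs → term rs v w))
    ≡⟨ pairSum-cong n (λ v w → ∑-oddPairs n p (intersections v w ≡ᵇ k) (end≤n v) (end≤n w)) ⟩
  pairSum n (λ v w → ⟦ (intersections v w ≡ᵇ k) ∧ sumsToOdd p (end 0 v ℕ.+ end 0 w) ⟧) ∎
  where
  open ≡-Reasoning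
  term : ℤ × ℤ → Path n → Path n → ℤ
  term (r , s) v w = ⟦ does (+ end 0 v ℤ.≟ r) ∧ does (+ end 0 w ℤ.≟ s) ∧ (intersections v w ≡ᵇ k) ⟧
  end≤n : ∀ (u : Path n) → end 0 u ℕ.≤ n
  end≤n u = subst (end 0 u ℕ.≤_) (ℕ.+-identityʳ n) (end≤ 0 u)

-- Counting bridges by binomial coefficients.

binom-suc : ∀ n z → binom (suc n) z ≡ binom n (z - 1ℤ) ℕ.+ binom n z
binom-suc n (+ zero)  = refl
binom-suc n (+ suc k) = sym (nCk+nC[k+1]≡[n+1]C[k+1] n k)
binom-suc n -[1+ k ]  = refl

binom₀ : ∀ p a → ⟦ isTarget p a ⟧ ≡ + binom 0 (p - + a)
binom₀ p a with + a ℤ.≟ p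
... | yes refl rewrite ℤ.+-inverseʳ (+ a) = refl
... | no a≢p with p - + a in eq
...   | + zero  = contradiction (sym (ℤ.i-j≡0⇒i≡j p (+ a) eq)) a≢p
...   | + suc k = cong +_ (sym (k>n⇒nCk≡0 {0} {suc k} (ℕ.s≤s ℕ.z≤n)))
...   | -[1+ k ] = refl

-- With meetings disregarded the two paths are independent, so the count factors. Each factor
-- chooses the p - a (or p - b) east steps among `n`, by Pascal's rule.
free-bridges : ∀ p n a b → free n (bridges p) a b ≡ + binom n (p - + a) * + binom n (p - + b)
free-bridges p zero    a b = trans (⟦∧⟧ (isTarget p a) (isTarget p b)) (cong₂ _*_ (binom₀ p a) (binom₀ p b))
  where
  ⟦∧⟧ : ∀ c d → ⟦ c ∧ d ⟧ ≡ ⟦ c ⟧ * ⟦ d ⟧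
  ⟦∧⟧ true  true  = refl
  ⟦∧⟧ true  false = refl
  ⟦∧⟧ false _     = refl
free-bridges p (suc n) a b = begin
  free (suc n) (bridges p) a b
    ≡⟨ cong₂ _+_ (cong₂ _+_ (free-bridges p n _ _) (free-bridges p n _ _))
                 (cong₂ _+_ (free-bridges p n _ _) (free-bridges p n _ _)) ⟩
  spread (λ x y → β x * β y) a b
    ≡⟨ factor (β (suc a)) (β a) (β (suc b)) (β b) ⟩
  (β (suc a) + β a) * (β (suc b) + β b)
    ≡⟨ cong₂ _*_ (pascal a) (pascal b) ⟨
  + binom (suc n) (p - + a) * + binom (suc n) (p - + b) ∎
  where
  open ≡-Reasoning
  β : ℕ → ℤ
  β x = + binom n (p - + x)
  factor : ∀ x y z t → x * z + x * t + (y * z + y * t) ≡ (x + y) * (z + t)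
  factor = solve-∀
  shift : ∀ q x → q - x - 1ℤ ≡ q - (1ℤ + x)
  shift = solve-∀
  pascal : ∀ x → + binom (suc n) (p - + x) ≡ β (suc x) + β x
  pascal x = cong +_ (trans (binom-suc n (p - + x))
    (cong (λ z → binom n z ℕ.+ binom n (p - + x)) (shift p (+ x))))

bridge-count : ∀ p n → free n (bridges p) 0 0 ≡ + (binom n p ^ 2)
bridge-count p n = begin
  free n (bridges p) 0 0                     ≡⟨ free-bridges p n 0 0 ⟩
  + binom n (p - 0ℤ) * + binom n (p - 0ℤ)    ≡⟨ cong (λ z → + binom n z * + binom n z) (ℤ.+-identityʳ p) ⟩
  + binom n p * + binom n p                  ≡⟨ ℤ.pos-* (binom n p) (binom n p) ⟨
  + (binom n p ℕ.* binom n p)                ≡⟨ cong (λ x → + (binom n p ℕ.* x)) (ℕ.*-identityʳ (binom n p)) ⟨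
  + (binom n p ^ 2) ∎
  where open ≡-Reasoning

-- Bridges with few meetings, and the final formula.

Nₑ-sum : ∀ n K p → + sum (map (λ i → Nₑ i n p) (upTo K)) ≡ pairSum n λ v w →
  ⟦ (intersections v w <ᵇ K) ∧ bridge p (end 0 v) (end 0 w) ⟧
Nₑ-sum n K p = begin
  + sum (map (λ i → Nₑ i n p) (upTo K))
    ≡⟨ sum-∑ (λ i → Nₑ i n p) (upTo K) ⟩
  ∑ (upTo K) (λ i → + Nₑ i n p)
    ≡⟨ ∑-cong (upTo K) (λ i → M-pairSum n i p p) ⟩
  ∑ (upTo K) (λ i → pairSum n (term i))
    ≡⟨ pairSum-∑ n (upTo K) term ⟩
  pairSum n (λ v w → ∑ (upTo K) (λ i → term i v w))
    ≡⟨ pairSum-cong n (λ v w → trans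
         (∑-cong (upTo K) (λ i → pull (isTarget p (end 0 v)) (isTarget p (end 0 w)) (intersections v w ≡ᵇ i)))
         (trans (∑-sift K (intersections v w) (λ _ → bridges p (end 0 v) (end 0 w)))
                (push (intersections v w <ᵇ K)))) ⟩
  pairSum n (λ v w → ⟦ (intersections v w <ᵇ K) ∧ bridge p (end 0 v) (end 0 w) ⟧) ∎
  where
  open ≡-Reasoning
  term : ℕ → Path n → Path n → ℤ
  term i v w = ⟦ isTarget p (end 0 v) ∧ isTarget p (end 0 w) ∧ (intersections v w ≡ᵇ i) ⟧
  pull : ∀ a b c → ⟦ a ∧ b ∧ c ⟧ ≡ (if c then ⟦ a ∧ b ⟧ else 0ℤ)
  pull true  true  true  = refl
  pull true  true  false = refl
  pull true  false true  = refl
  pull true  false false = refl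
  pull false _     true  = refl
  pull false _     false = refl
  push : ∀ c {d} → (if c then ⟦ d ⟧ else 0ℤ) ≡ ⟦ c ∧ d ⟧
  push true  = refl
  push false = refl

-- `j <ᵇ suc i` tests j ≤ i, so exactly one of the two tests succeeds.
complement : ∀ j i d → ⟦ (j <ᵇ suc i) ∧ d ⟧ + ⟦ (i <ᵇ j) ∧ d ⟧ ≡ ⟦ d ⟧
complement zero    i       d = ℤ.+-identityʳ _
complement (suc j) zero    d = ℤ.+-identityˡ _
complement (suc j) (suc i) d = complement j i d

-- At positive length, `k` at most `visits` means that `k ∸ 1` is at most `intersections`, so the
-- two sums split all bridges. Length 0 needs separate care, as its start is not a visit.
Y-complement : ∀ n k p → ¬ (suc n ≡ 1 × k ≡ 1 × p ≡ 0ℤ) →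
  Y p n k 0 0 + + sum (map (λ i → Nₑ i n p) (upTo (k ∸ 1))) ≡ + (binom n p ^ 2)
Y-complement n k p ¬bad = begin
  Y p n k 0 0 + + sum (map (λ i → Nₑ i n p) (upTo (k ∸ 1)))
    ≡⟨ cong (_+_ (Y p n k 0 0)) (Nₑ-sum n (k ∸ 1) p) ⟩
  Y p n k 0 0 + pairSum n (λ v w → ⟦ (intersections v w <ᵇ k ∸ 1) ∧ bridge p (end 0 v) (end 0 w) ⟧)
    ≡⟨ pairSum-+ n _ _ ⟨
  pairSum n (λ v w → ⟦ (k <ᵇ suc (visits 0 0 v w)) ∧ bridge p (end 0 v) (end 0 w) ⟧ +
                     ⟦ (intersections v w <ᵇ k ∸ 1) ∧ bridge p (end 0 v) (end 0 w) ⟧)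
    ≡⟨ pairSum-cong n (pointwise n k ¬bad) ⟩
  free n (bridges p) 0 0
    ≡⟨ bridge-count p n ⟩
  + (binom n p ^ 2) ∎
  where
  open ≡-Reasoning
  pointwise : ∀ n k → ¬ (suc n ≡ 1 × k ≡ 1 × p ≡ 0ℤ) → (v w : Path n) →
    ⟦ (k <ᵇ suc (visits 0 0 v w)) ∧ bridge p (end 0 v) (end 0 w) ⟧ +
    ⟦ (intersections v w <ᵇ k ∸ 1) ∧ bridge p (end 0 v) (end 0 w) ⟧ ≡ bridges p (end 0 v) (end 0 w)
  -- For k = 0 the first test always holds, and `k ∸ 1` truncates to 0, so the second never does.
  pointwise n       zero          _    v      w      = ℤ.+-identityʳ _
  pointwise (suc n) (suc k)       _    v      w      rewrite visits≡1+intersections v w =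
    complement k (intersections v w) _
  -- Both tests fail for the empty pair, so it must not be a bridge: this is p ≠ 0.
  pointwise zero    (suc zero)    ¬bad [] []
    rewrite dec-false (0ℤ ℤ.≟ p) (λ 0≡p → ¬bad (refl , refl , sym 0≡p)) = refl
  pointwise zero    (suc (suc k)) _    [] [] = ℤ.+-identityˡ _

theorem2 : (n k : ℕ) (p : ℤ) → n > 0 →
    ¬ (n ≡ 1 × k ≡ 1 × p ≡ 0ℤ) →
    + N-O n k p ≡
      + 2 * (+ (binom (n ∸ 1) p ^ 2) - + sum (map (λ i → Nₑ i (n ∸ 1) p) (upTo (k ∸ 1))))
theorem2 (suc n) k p _ ¬bad = begin
  + N-O (suc n) k p
    ≡⟨ N-O-pairSum (suc n) k p ⟩
  pairSum (suc n) (λ v w → ⟦ (intersections v w ≡ᵇ k) ∧ sumsToOdd p (end 0 v ℕ.+ end 0 w) ⟧)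
    -- Counting the common start raises the number of meetings from `k` to `suc k`.
    ≡⟨ pairSum-cong (suc n) (λ v w → cong (λ i → ⟦ (i ≡ᵇ suc k) ∧ sumsToOdd p (end 0 v ℕ.+ end 0 w) ⟧)
         (sym (visits≡1+intersections v w))) ⟩
  Z p (suc n) (suc k) 0 0
    ≡⟨ Z≡2Y p n k 0 0 ⟩
  + 2 * Y p n k 0 0
    ≡⟨ cong (+ 2 *_) (trans (isolate (Y p n k 0 0) S) (cong (_- S) (Y-complement n k p ¬bad))) ⟩
  + 2 * (+ (binom n p ^ 2) - S) ∎
  where
  open ≡-Reasoning
  S : ℤ
  S = + sum (map (λ i → Nₑ i n p) (upTo (k ∸ 1)))
  isolate : ∀ y s → y ≡ (y + s) - s
  isolate = solve-∀
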